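{- Let $\mu$ be a signature consisting of a single ternary relation symbol. There is an $\aleph_1$-bounded ideal $\mathcal A$ of $\Omega^*_\mu$ which is not representable.
   Context: A relational structure of signature $\mu$ here is a pair $(A;T)$ with $T$ a ternary relation on the set $A$. An embedding is an injective map preserving and reflecting $T$; $\mathfrak A\le\mathfrak B$ means $\mathfrak A$ embeds into $\mathfrak B$. $\Omega^*_\mu$ is the class of isomorphism types of (arbitrary cardinality) relational structures of signature $\mu$, quasi-ordered by $\le$. An ideal of $\Omega^*_\mu$ is a non-empty set (not a proper class) of such isomorphism types which is downward closed under $\le$ and up-directed. An ideal $\mathcal A$ is $\kappa$-bounded if all its elements have cardinality less than $\kappa$ and for every cardinal $\lambda<\kappa$ there is an element of $\mathcal A$ of cardinality $\lambda$. An ideal $\mathcal J$ of subsets of a set $A$ is a non-empty family of subsets of $A$ that is closed under taking subsets and up-directed under inclusion. For a relational structure $\mathfrak A$ and an ideal $\mathcal J$ of subsets of $A$, $\mathrm{age}_{\mathcal J}(\mathfrak A)$ is the set of isomorphism types of the induced substructures $\mathfrak A_{\restriction S}$ for $S\in\mathcal J$. An ideal $\mathcal C$ of $\Omega^*_\mu$ is representable if there exist a relational structure $\mathfrak A$ of signature $\mu$ and an ideal $\mathcal J$ of subsets of $A$ with $\mathrm{age}_{\mathcal J}(\mathfrak A)=\mathcal C$. -}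

module Defs where

open import Data.Nat.Base using (ℕ)
open import Data.Product.Base using (Σ-syntax; ∃-syntax; _×_)
open import Data.Refinement.Base using (Refinement; value)
open import Function.Bundles using (_⇔_; _↔_; _↣_)
open import Function.Definitions using (Injective; Surjective)
open import Level using (Level; suc)
open import Relation.Binary.PropositionalEquality.Core using (_≡_)
open import Relation.Unary using (Pred; _∈_; _⊆_)

-- Throughout, Set ℓ plays the role of the universe of sets, so that families
-- indexed by a type in Set ℓ are sets, whereas predicates on Structure ℓ are
-- classes.

record Structure (ℓ : Level) : Set (suc ℓ) where
  constructor structure
  field
    Carrier : Set ℓ
    T       : Carrier → Carrier → Carrier → Set ℓ

open Structure public

-- T is only ever compared up to logical equivalence, so it is a relation
-- even though its values need not be proof-irrelevant.

record IsEmbedding {ℓ} (𝔄 𝔅 : Structure ℓ)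
                   (f : Carrier 𝔄 → Carrier 𝔅) : Set ℓ where
  field
    injective : Injective _≡_ _≡_ f
    relation  : ∀ x y z → T 𝔄 x y z ⇔ T 𝔅 (f x) (f y) (f z)

infix 4 _≤_ _≅_

_≤_ : ∀ {ℓ} → Structure ℓ → Structure ℓ → Set ℓ
𝔄 ≤ 𝔅 = ∃[ f ] IsEmbedding 𝔄 𝔅 f

_≅_ : ∀ {ℓ} → Structure ℓ → Structure ℓ → Set ℓ
𝔄 ≅ 𝔅 = ∃[ f ] (IsEmbedding 𝔄 𝔅 f × Surjective _≡_ _≡_ f)

-- In Refinement the proof of membership is irrelevant, so two elements of the
-- restriction are equal exactly when they are equal in 𝔄.

infixl 7 _↾_

_↾_ : ∀ {ℓ} (𝔄 : Structure ℓ) → Pred (Carrier 𝔄) ℓ → Structure ℓ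
𝔄 ↾ S = structure (Refinement (Carrier 𝔄) S)
                  (λ x y z → T 𝔄 (value x) (value y) (value z))

-- A class of isomorphism types is given by a predicate on structures; for an
-- ideal, invariance under isomorphism follows from downward closure.

Class : (ℓ : Level) → Set (suc (suc ℓ))
Class ℓ = Pred (Structure ℓ) (suc ℓ)

-- Not a proper class: the types in 𝒜 are those of a family indexed by a set.

IsSmall : ∀ {ℓ} → Class ℓ → Set (suc ℓ)
IsSmall {ℓ} 𝒜 =
  Σ[ I ∈ Set ℓ ] Σ[ F ∈ (I → Structure ℓ) ]
    (∀ 𝔅 → 𝔅 ∈ 𝒜 ⇔ (∃[ i ] 𝔅 ≅ F i))

record IsIdeal {ℓ} (𝒜 : Class ℓ) : Set (suc ℓ) where
  field
    small      : IsSmall 𝒜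
    nonEmpty   : ∃[ 𝔄 ] 𝔄 ∈ 𝒜
    downClosed : ∀ {𝔄 𝔅} → 𝔄 ≤ 𝔅 → 𝔅 ∈ 𝒜 → 𝔄 ∈ 𝒜
    directed   : ∀ {𝔄 𝔅} → 𝔄 ∈ 𝒜 → 𝔅 ∈ 𝒜 →
                 ∃[ ℭ ] (ℭ ∈ 𝒜 × 𝔄 ≤ ℭ × 𝔅 ≤ ℭ)

-- A cardinal κ is represented by the class of all sets of cardinality < κ.
-- As ℵ₁ is the successor of ℵ₀, a set has cardinality < ℵ₁ iff it has
-- cardinality ≤ ℵ₀.

ℵ₁ : ∀ {ℓ} → Pred (Set ℓ) ℓ
ℵ₁ X = X ↣ ℕ

record IsBounded {ℓ} (κ : Pred (Set ℓ) ℓ) (𝒜 : Class ℓ) : Set (suc ℓ) where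
  field
    below    : ∀ {𝔄} → 𝔄 ∈ 𝒜 → Carrier 𝔄 ∈ κ
    attained : ∀ {X} → X ∈ κ → ∃[ 𝔄 ] (𝔄 ∈ 𝒜 × (Carrier 𝔄 ↔ X))

record IsSubsetIdeal {ℓ} {A : Set ℓ} (𝒥 : Pred (Pred A ℓ) (suc ℓ)) :
                     Set (suc ℓ) where
  field
    nonEmpty   : ∃[ S ] S ∈ 𝒥
    downClosed : ∀ {S S′} → S ⊆ S′ → S′ ∈ 𝒥 → S ∈ 𝒥
    directed   : ∀ {S S′} → S ∈ 𝒥 → S′ ∈ 𝒥 →
                 ∃[ U ] (U ∈ 𝒥 × S ⊆ U × S′ ⊆ U)

age : ∀ {ℓ} (𝔄 : Structure ℓ) → Pred (Pred (Carrier 𝔄) ℓ) (suc ℓ) → Class ℓ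
age 𝔄 𝒥 𝔅 = ∃[ S ] (S ∈ 𝒥 × 𝔅 ≅ 𝔄 ↾ S)

Representable : ∀ {ℓ} → Class ℓ → Set (suc (suc ℓ))
Representable {ℓ} 𝒞 =
  Σ[ 𝔄 ∈ Structure ℓ ] Σ[ 𝒥 ∈ Pred (Pred (Carrier 𝔄) ℓ) (suc ℓ) ]
    (IsSubsetIdeal 𝒥 × (∀ 𝔅 → 𝔅 ∈ age 𝔄 𝒥 ⇔ 𝔅 ∈ 𝒞))

-- A model consists of a rigid copy of ℕ together with finitely many points p,
-- each of which traces a subset of ℕ, and a colouring of pairs of points by
-- naturals such that every map p ↦ colour q p is injective.  Finiteness leaves
-- fresh colours, so two models embed in the disjoint union of their sets of
-- points over the same ℕ.  In a representation the copy of ℕ is unique, whence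
-- a fixed point q colours all the points injectively by naturals; but every
-- subset of ℕ is traced by some point, contradicting Cantor's diagonal argument.

module Submission where

open import Defs
open import Axiom.ExcludedMiddle using (ExcludedMiddle)
open import Data.Bool.Base using (Bool; true; false) renaming (T to IsTrue)
open import Data.Empty using (⊥)
open import Data.Fin.Base as Fin using (Fin; toℕ; splitAt; join; _↑ˡ_; _↑ʳ_)
open import Data.Fin.Properties using (toℕ-injective; toℕ<n; splitAt-↑ˡ; splitAt-↑ʳ; ↑ˡ-injective; ↑ʳ-injective;
  join-splitAt)
open import Data.Irrelevant using ([_])
open import Data.Nat.Base as ℕ using (ℕ; _+_; _<_)
open import Data.Nat.Properties using (+-cancelˡ-≡; +-monoʳ-<; m≤m+n; <-≤-trans; <⇒≢)
open import Data.Product using (Σ-syntax; ∃-syntax; _×_; _,_; proj₁; proj₂)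
open import Data.Refinement.Base using (Refinement; value; refine) renaming (_,_ to _,ʳ_)
open import Data.Sum.Base using (_⊎_; inj₁; inj₂; [_,_]′; swap)
open import Function.Base using (_∘_; id)
open import Function.Bundles using (Equivalence; Injection; mk⇔; mk↣; _↣_; _⇔_)
open import Function.Construct.Composition using (_⇔-∘_)
open import Function.Construct.Identity using (⇔-id; ↔-id)
open import Function.Definitions using (Injective; Surjective)
open import Level using (Level; suc; Lift; lift; lower)
open import Relation.Binary.PropositionalEquality using (_≡_; refl; sym; trans; cong; subst; subst₂;
  module ≡-Reasoning)
open import Relation.Nullary using (¬_; Dec; yes; no; does; contradiction)
open import Relation.Nullary.Decidable using (map′; recompute; ⌊_⌋; fromWitness; toWitness)
open import Relation.Unary using (Pred; _∈_; _⊆_)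

open IsEmbedding
open Equivalence using (to; from)

private variable
  ℓ : Level

-- Embeddings and induced substructures.

≤-refl : {𝔄 : Structure ℓ} → 𝔄 ≤ 𝔄
≤-refl = id , record { injective = id ; relation = λ _ _ _ → ⇔-id _ }

≤-trans : {𝔄 𝔅 ℭ : Structure ℓ} → 𝔄 ≤ 𝔅 → 𝔅 ≤ ℭ → 𝔄 ≤ ℭ
≤-trans (f , f-emb) (g , g-emb) = g ∘ f , record
  { injective = injective f-emb ∘ injective g-emb
  ; relation  = λ x y z → relation g-emb (f x) (f y) (f z) ⇔-∘ relation f-emb x y z
  }

≅⇒≤ : {𝔄 𝔅 : Structure ℓ} → 𝔄 ≅ 𝔅 → 𝔄 ≤ 𝔅
≅⇒≤ (f , f-emb , _) = f , f-emb

≅-refl : {𝔄 : Structure ℓ} → 𝔄 ≅ 𝔄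
≅-refl {𝔄 = 𝔄} = id , proj₂ (≤-refl {𝔄 = 𝔄}) , λ y → y , id

value-injective : {A : Set ℓ} {P : Pred A ℓ} → Injective _≡_ _≡_ (value {P = P})
value-injective {x = _ ,ʳ _} {y = _ ,ʳ _} refl = refl

↾-≤ : (𝔄 : Structure ℓ) (S : Pred (Carrier 𝔄) ℓ) → 𝔄 ↾ S ≤ 𝔄
↾-≤ 𝔄 S = value , record { injective = value-injective ; relation = λ _ _ _ → ⇔-id _ }

↾-mono : (𝔄 : Structure ℓ) {S U : Pred (Carrier 𝔄) ℓ} → S ⊆ U → 𝔄 ↾ S ≤ 𝔄 ↾ U
↾-mono 𝔄 S⊆U = (λ { (x ,ʳ [ x∈S ]) → x ,ʳ [ S⊆U x∈S ] }) , record
  { injective = λ eq → value-injective (cong value eq)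
  ; relation  = λ _ _ _ → ⇔-id _
  }

-- Injective colourings with bounded range.

record Colouring (A : Set) : Set where
  field
    colour           : A → ℕ
    colour-injective : Injective _≡_ _≡_ colour
    bound            : ℕ
    colour<bound     : ∀ a → colour a < bound

open Colouring

private variable
  A B : Set
  m n : ℕ

toℕ-colouring : Colouring (Fin n)
toℕ-colouring {n} = record
  { colour           = toℕ
  ; colour-injective = toℕ-injective
  ; bound            = n
  ; colour<bound     = toℕ<n
  }

infixr 1 _⊎-colouring_

-- Shifting `ψ` past `bound χ` separates the two ranges, while `χ` keeps its colours; amalgamation
-- relies on this asymmetry.
_⊎-colouring_ : Colouring A → Colouring B → Colouring (A ⊎ B)
χ ⊎-colouring ψ = record
  { colour           = [ colour χ , (bound χ +_) ∘ colour ψ ]′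
  ; colour-injective = inj
  ; bound            = bound χ + bound ψ
  ; colour<bound     = λ where
      (inj₁ a) → <-≤-trans (colour<bound χ a) (m≤m+n _ _)
      (inj₂ b) → +-monoʳ-< (bound χ) (colour<bound ψ b)
  }
  where
  inj : Injective _≡_ _≡_ [ colour χ , (bound χ +_) ∘ colour ψ ]′
  inj {inj₁ _} {inj₁ _} eq = cong inj₁ (colour-injective χ eq)
  inj {inj₁ a} {inj₂ _} eq = contradiction eq (<⇒≢ (<-≤-trans (colour<bound χ a) (m≤m+n _ _)))
  inj {inj₂ _} {inj₁ a} eq = contradiction (sym eq) (<⇒≢ (<-≤-trans (colour<bound χ a) (m≤m+n _ _)))
  inj {inj₂ _} {inj₂ _} eq = cong inj₂ (colour-injective ψ (+-cancelˡ-≡ (bound χ) _ _ eq))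

reindex : (f : A → B) → Injective _≡_ _≡_ f → Colouring B → Colouring A
reindex f f-inj χ = record
  { colour           = colour χ ∘ f
  ; colour-injective = f-inj ∘ colour-injective χ
  ; bound            = bound χ
  ; colour<bound     = colour<bound χ ∘ f
  }

splitAt-injective : ∀ m {n} → Injective _≡_ _≡_ (splitAt m {n})
splitAt-injective m {n} {i} {j} eq = begin
  i                      ≡⟨ join-splitAt m n i ⟨
  join m n (splitAt m i) ≡⟨ cong (join m n) eq ⟩
  join m n (splitAt m j) ≡⟨ join-splitAt m n j ⟩
  j                      ∎
  where open ≡-Reasoning

swap-injective : Injective _≡_ _≡_ (swap {A = A} {B = B})
swap-injective {x = inj₁ _} {y = inj₁ _} refl = refl
swap-injective {x = inj₂ _} {y = inj₂ _} refl = refl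

-- Blueprints and their models.

record Blueprint : Set where
  field
    size      : ℕ
    trace     : Fin size → ℕ → Bool
    colouring : Fin size → Colouring (Fin size)

open Blueprint

data Element {ℓ} (n : ℕ) : Set ℓ where
  base  : ℕ → Element n
  point : Fin n → Element n

-- The zero of ℕ is singled out by its relation to the points, and points are
-- singled out by lying on the diagonal of the relation.

data Rel {ℓ} (d : Blueprint) : (x y z : Element {ℓ} (size d)) → Set ℓ where
  zeroᵇ   : ∀ {p q} → Rel d (base 0) (point p) (point q)
  sucᵇ    : ∀ {k} → Rel d (base k) (base k) (base (ℕ.suc k))
  traceᵇ  : ∀ {p k} → trace d p k ≡ true → Rel d (base k) (base k) (point p)
  colourᵖ : ∀ {p q k} → colour (colouring d q) p ≡ k → Rel d (point q) (point p) (base k)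
  allᵖ    : ∀ {p q r} → Rel d (point p) (point q) (point r)

model : Blueprint → Structure ℓ
model d = structure (Element (size d)) (Rel d)

base-injective : ∀ {j k} → base {ℓ} {n} j ≡ base k → j ≡ k
base-injective refl = refl

point-injective : ∀ {i j} → point {ℓ} {n} i ≡ point j → i ≡ j
point-injective refl = refl

model-≤ : (d e : Blueprint) (σ : Fin (size d) → Fin (size e)) →
  Injective _≡_ _≡_ σ →
  (∀ p k → trace e (σ p) k ≡ trace d p k) →
  (∀ q p → colour (colouring e (σ q)) (σ p) ≡ colour (colouring d q) p) →
  model {ℓ} d ≤ model e
model-≤ {ℓ} d e σ σ-inj σ-trace σ-colour = f , record
  { injective = f-inj
  ; relation  = λ x y z → mk⇔ (f-to x y z) (f-from x y z)
  }
  where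
  f : Element {ℓ} (size d) → Element (size e)
  f (base k)  = base k
  f (point p) = point (σ p)

  f-inj : Injective _≡_ _≡_ f
  f-inj {base _}  {base _}  refl = refl
  f-inj {point _} {point _} eq   = cong point (σ-inj (point-injective eq))

  f-to : ∀ x y z → Rel d x y z → Rel e (f x) (f y) (f z)
  f-to _ _ _ zeroᵇ        = zeroᵇ
  f-to _ _ _ sucᵇ         = sucᵇ
  f-to _ _ _ (traceᵇ eq)  = traceᵇ (trans (σ-trace _ _) eq)
  f-to _ _ _ (colourᵖ eq) = colourᵖ (trans (σ-colour _ _) eq)
  f-to _ _ _ allᵖ         = allᵖ

  f-from : ∀ x y z → Rel e (f x) (f y) (f z) → Rel d x y z
  f-from (base _)  (point _) (point _) zeroᵇ        = zeroᵇ
  f-from (base _)  (base _)  (base _)  sucᵇ         = sucᵇ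
  f-from (base _)  (base _)  (point _) (traceᵇ eq)  = traceᵇ (trans (sym (σ-trace _ _)) eq)
  f-from (point _) (point _) (base _)  (colourᵖ eq) = colourᵖ (trans (sym (σ-colour _ _)) eq)
  f-from (point _) (point _) (point _) allᵖ         = allᵖ

-- Amalgamation over the common copy of ℕ.

amalgam : Blueprint → Blueprint → Blueprint
amalgam d e = record
  { size      = size d + size e
  ; trace     = λ p → [ trace d , trace e ]′ (split p)
  -- The colouring of `q` has to extend the one from its own blueprint, so that summand comes first
  -- and the other points get fresh colours; `swap` arranges this for `q` from `e`.
  ; colouring = λ q → [ (λ q → reindex split split-inj
                                 (colouring d q ⊎-colouring toℕ-colouring))
                      , (λ q → reindex (swap ∘ split) (split-inj ∘ swap-injective)
                                 (colouring e q ⊎-colouring toℕ-colouring))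
                      ]′ (split q)
  }
  where
  split : Fin (size d + size e) → Fin (size d) ⊎ Fin (size e)
  split = splitAt (size d)

  split-inj : Injective _≡_ _≡_ split
  split-inj = splitAt-injective (size d)

amalgamˡ : ∀ d e → model {ℓ} d ≤ model (amalgam d e)
amalgamˡ d e = model-≤ d (amalgam d e) (_↑ˡ size e) (↑ˡ-injective _ _ _) trace≡ colour≡
  where
  trace≡ : ∀ p k → trace (amalgam d e) (p ↑ˡ size e) k ≡ trace d p k
  trace≡ p k rewrite splitAt-↑ˡ (size d) p (size e) = refl

  colour≡ : ∀ q p → colour (colouring (amalgam d e) (q ↑ˡ size e)) (p ↑ˡ size e) ≡
                    colour (colouring d q) p
  colour≡ q p rewrite splitAt-↑ˡ (size d) q (size e)
                    | splitAt-↑ˡ (size d) p (size e) = refl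

amalgamʳ : ∀ d e → model {ℓ} e ≤ model (amalgam d e)
amalgamʳ d e = model-≤ e (amalgam d e) (size d ↑ʳ_) (↑ʳ-injective _ _ _) trace≡ colour≡
  where
  trace≡ : ∀ p k → trace (amalgam d e) (size d ↑ʳ p) k ≡ trace e p k
  trace≡ p k rewrite splitAt-↑ʳ (size d) (size e) p = refl

  colour≡ : ∀ q p → colour (colouring (amalgam d e) (size d ↑ʳ q)) (size d ↑ʳ p) ≡
                    colour (colouring e q) p
  colour≡ q p rewrite splitAt-↑ʳ (size d) (size e) q
                    | splitAt-↑ʳ (size d) (size e) p = refl

-- Basic blueprints and rigidity of the copy of ℕ.

pointless : Blueprint
pointless = record { size = 0 ; trace = λ () ; colouring = λ () }

singleton : (ℕ → Bool) → Blueprint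
singleton t = record { size = 1 ; trace = λ _ → t ; colouring = λ _ → toℕ-colouring }

Rel-diagonal : ∀ {d x} → Rel {ℓ} d x x x → ∃[ p ] x ≡ point p
Rel-diagonal allᵖ = _ , refl

base0-unique : ∀ {d x p q} → Rel {ℓ} d x (point p) (point q) → ¬ Rel d x x x → x ≡ base 0
base0-unique zeroᵇ _    = refl
base0-unique allᵖ  ¬xxx = contradiction allᵖ ¬xxx

suc-unique : ∀ {d x k} → Rel {ℓ} d (base k) (base k) x → ¬ Rel d x x x → x ≡ base (ℕ.suc k)
suc-unique sucᵇ       _    = refl
suc-unique (traceᵇ _) ¬xxx = contradiction allᵖ ¬xxx

colour-cancel : ∀ {d q k x y} →
  Rel {ℓ} d (point q) x (base k) → Rel d (point q) y (base k) → x ≡ y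
colour-cancel {d = d} {q} (colourᵖ eq) (colourᵖ eq′) =
  cong point (colour-injective (colouring d q) (trans eq (sym eq′)))

coloured-at : ∀ {d q p x y z} → x ≡ point q → y ≡ point p →
  z ≡ base (colour (colouring d q) p) → Rel {ℓ} d x y z
coloured-at refl refl refl = colourᵖ refl

-- Only points lie on the diagonal, so the point goes to a point and no `base k` does. Off the
-- diagonal, `zeroᵇ` alone can relate an element to two points, and `sucᵇ` alone can continue from
-- `base k`; induction then fixes every `base k`.
module Rigidity {ℓ} {t : ℕ → Bool} {d : Blueprint} (φ : model {ℓ} (singleton t) ≤ model d) where
  private
    f     = proj₁ φ
    f-emb = proj₂ φ

  point↦point : ∃[ p ] f (point Fin.zero) ≡ point p
  point↦point = Rel-diagonal (to (relation f-emb _ _ _) allᵖ)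

  base-¬diagonal : ∀ k → ¬ Rel d (f (base k)) (f (base k)) (f (base k))
  base-¬diagonal k r with () ← from (relation f-emb (base k) (base k) (base k)) r

  base↦base : ∀ k → f (base k) ≡ base k
  base↦base ℕ.zero = base0-unique
    (subst (λ x → Rel d (f (base 0)) x x) (proj₂ point↦point)
      (to (relation f-emb _ _ _) (zeroᵇ {p = Fin.zero} {q = Fin.zero})))
    (base-¬diagonal 0)
  base↦base (ℕ.suc k) = suc-unique
    (subst (λ x → Rel d x x (f (base (ℕ.suc k)))) (base↦base k)
      (to (relation f-emb _ _ _) sucᵇ))
    (base-¬diagonal (ℕ.suc k))

-- The ideal generated by the models.

𝒜 : Class ℓ
𝒜 {ℓ} 𝔅 = Lift (suc ℓ) (∃[ d ] 𝔅 ≤ model d)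

model∈𝒜 : ∀ d → model {ℓ} d ∈ 𝒜
model∈𝒜 d = lift (d , ≤-refl)

Element↣ℕ : Element {ℓ} n ↣ ℕ
Element↣ℕ {ℓ} {n} = mk↣ {to = code} code-inj
  where
  code : Element {ℓ} n → ℕ
  code (base k)  = n + k
  code (point p) = toℕ p

  code-inj : Injective _≡_ _≡_ code
  code-inj {base _}  {base _}  eq = cong base (+-cancelˡ-≡ n _ _ eq)
  code-inj {base _}  {point p} eq = contradiction (sym eq) (<⇒≢ (<-≤-trans (toℕ<n p) (m≤m+n _ _)))
  code-inj {point p} {base _}  eq = contradiction eq (<⇒≢ (<-≤-trans (toℕ<n p) (m≤m+n _ _)))
  code-inj {point _} {point _} eq = cong point (toℕ-injective eq)

𝒜-bounded : IsBounded ℵ₁ (𝒜 {ℓ})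
𝒜-bounded = record
  { below    = λ { (lift (d , f , f-emb)) →
                   mk↣ (injective f-emb ∘ Injection.injective Element↣ℕ) }
  ; attained = λ {X} ι →
      let f = base ∘ Injection.to ι in
      structure X (λ x y z → Rel pointless (f x) (f y) (f z))
      , lift (pointless , f , record
          { injective = Injection.injective ι ∘ base-injective
          ; relation  = λ _ _ _ → ⇔-id _ })
      , ↔-id X
  }

module _ (em : ExcludedMiddle (suc ℓ)) where

  private
    em₀ : ExcludedMiddle ℓ
    em₀ = map′ lower lift em

  𝒜-small : IsSmall (𝒜 {ℓ})
  𝒜-small = Index , F , λ 𝔅 → mk⇔ index member
    where
    -- Subsets are coded by Boolean functions, since predicates valued in `Set ℓ` would raise the
    -- index type to level `suc ℓ`. Excluded middle decides every image, so no substructure is lost.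
    Index : Set ℓ
    Index = Σ[ d ∈ Blueprint ] (Element {ℓ} (size d) → Bool)

    F : Index → Structure ℓ
    F (d , s) = model d ↾ (λ x → Lift ℓ (IsTrue (s x)))

    index : ∀ {𝔅} → 𝔅 ∈ 𝒜 → ∃[ i ] 𝔅 ≅ F i
    index (lift (d , f , f-emb)) = (d , λ x → ⌊ image? x ⌋) , g , record
      { injective = injective f-emb ∘ cong value
      ; relation  = relation f-emb
      } , g-surj
      where
      image? : ∀ x → Dec (∃[ y ] f y ≡ x)
      image? x = em₀

      g : _ → Carrier (F (d , λ x → ⌊ image? x ⌋))
      g y = f y ,ʳ [ lift (fromWitness (y , refl)) ]

      g-surj : Surjective _≡_ _≡_ g
      -- The membership proof is irrelevant; `recompute` recovers a usable preimage from the
      -- decision `image? x`.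
      g-surj (x ,ʳ [ x∈image ])
        with y , refl ← recompute (image? x) (toWitness (lower x∈image)) =
        y , λ { refl → refl }

    member : ∀ {𝔅} → (∃[ i ] 𝔅 ≅ F i) → 𝔅 ∈ 𝒜
    member ((d , s) , iso) = lift (d , ≤-trans (≅⇒≤ iso) (↾-≤ _ _))

  𝒜-ideal : IsIdeal (𝒜 {ℓ})
  𝒜-ideal = record
    { small      = 𝒜-small
    ; nonEmpty   = model pointless , model∈𝒜 pointless
    ; downClosed = λ { 𝔄≤𝔅 (lift (d , 𝔅≤d)) → lift (d , ≤-trans 𝔄≤𝔅 𝔅≤d) }
    ; directed   = λ { (lift (d , 𝔄≤d)) (lift (e , 𝔅≤e)) →
                       model (amalgam d e) , model∈𝒜 (amalgam d e)
                       , ≤-trans 𝔄≤d (amalgamˡ d e) , ≤-trans 𝔅≤e (amalgamʳ d e) }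
    }

  -- Non-representability by diagonalisation.

  𝒜-not-representable : ¬ Representable (𝒜 {ℓ})
  𝒜-not-representable (𝔄 , 𝒥 , 𝒥-ideal , age⇔𝒜) = main
    where
    open IsSubsetIdeal 𝒥-ideal using (directed)

    realise : ∀ t → ∃[ S ] (S ∈ 𝒥 × model (singleton t) ≤ 𝔄 ↾ S)
    realise t with S , S∈𝒥 , iso ← from (age⇔𝒜 _) (model∈𝒜 (singleton t)) =
      S , S∈𝒥 , ≅⇒≤ iso

    -- The restriction to an upper bound `U` belongs to the age, hence to `𝒜`. Its model is where
    -- elements of different members of `𝒥` are compared.
    chart : ∀ {S S′} → S ∈ 𝒥 → S′ ∈ 𝒥 →
      ∃[ U ] (U ∈ 𝒥 × S ⊆ U × S′ ⊆ U × ∃[ d ] 𝔄 ↾ U ≤ model d)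
    chart S∈𝒥 S′∈𝒥
      with U , U∈𝒥 , S⊆U , S′⊆U ← directed S∈𝒥 S′∈𝒥
      with lift U≤d ← to (age⇔𝒜 _) (U , U∈𝒥 , ≅-refl) =
      U , U∈𝒥 , S⊆U , S′⊆U , U≤d

    -- Any trace would do here: the copy supplies the reference naturals `b` and the reference point
    -- `q`.
    S₀     = proj₁ (realise (λ _ → false))
    S₀∈𝒥   = proj₁ (proj₂ (realise (λ _ → false)))
    origin = proj₂ (proj₂ (realise (λ _ → false)))

    b : ℕ → Carrier 𝔄
    b k = value (proj₁ origin (base k))

    q : Carrier 𝔄
    q = value (proj₁ origin (point Fin.zero))

    -- `V` collects both points and `U` adds the reference copy. In the model for `U`, rigidity
    -- turns `q` into a point and `b k` into `base k`, so `colour-cancel` applies.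
    colour-unique : ∀ {S S′} → S ∈ 𝒥 → S′ ∈ 𝒥 →
      (p : Refinement (Carrier 𝔄) S) (p′ : Refinement (Carrier 𝔄) S′) → ∀ {k} →
      T 𝔄 q (value p) (b k) → T 𝔄 q (value p′) (b k) → value p ≡ value p′
    colour-unique S∈𝒥 S′∈𝒥 p p′ {k} qpk qp′k
      with V , V∈𝒥 , S⊆V , S′⊆V ← directed S∈𝒥 S′∈𝒥
      with U , U∈𝒥 , S₀⊆U , V⊆U , d , h , h-emb ← chart S₀∈𝒥 V∈𝒥
      = cong value (injective h-emb (colour-cancel
          (normalise (to (relation h-emb _ (refine (V⊆U ∘ S⊆V) p) _) qpk))
          (normalise (to (relation h-emb _ (refine (V⊆U ∘ S′⊆V) p′) _) qp′k))))
      where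
      open Rigidity (≤-trans origin (≤-trans (↾-mono 𝔄 S₀⊆U) (h , h-emb)))

      normalise = λ {x} → subst₂ (λ u w → Rel d u x w) (proj₂ point↦point) (base↦base k)

    -- The colour `k` is read off in a model receiving both copies. Rigidity sends both versions of
    -- `base k` to the same element, so they agree in `𝔄` and the trace can be tested at `b k`.
    coloured : ∀ {t S} → S ∈ 𝒥 → (e : model (singleton t) ≤ 𝔄 ↾ S) →
      let p = value (proj₁ e (point Fin.zero)) in
      ∃[ k ] (T 𝔄 q p (b k) × (t k ≡ true ⇔ T 𝔄 (b k) (b k) p))
    coloured {t} S∈𝒥 e
      with U , U∈𝒥 , S₀⊆U , S⊆U , d , h , h-emb ← chart S₀∈𝒥 S∈𝒥
      = k , from (relation h-emb _ _ _) qpk , trace⇔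
      where
      module R₀ = Rigidity (≤-trans origin (≤-trans (↾-mono 𝔄 S₀⊆U) (h , h-emb)))
      module R  = Rigidity (≤-trans e (≤-trans (↾-mono 𝔄 S⊆U) (h , h-emb)))

      k : ℕ
      k = colour (colouring d (proj₁ R₀.point↦point)) (proj₁ R.point↦point)

      qpk : Rel d (h (refine S₀⊆U (proj₁ origin (point Fin.zero))))
                  (h (refine S⊆U (proj₁ e (point Fin.zero))))
                  (h (refine S₀⊆U (proj₁ origin (base k))))
      qpk = coloured-at (proj₂ R₀.point↦point) (proj₂ R.point↦point) (R₀.base↦base k)

      base≡b : value (proj₁ e (base k)) ≡ b k
      base≡b = cong value (injective h-emb (trans (R.base↦base k) (sym (R₀.base↦base k))))

      trace⇔ : t k ≡ true ⇔ T 𝔄 (b k) (b k) (value (proj₁ e (point Fin.zero)))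
      trace⇔ = subst (λ u → t k ≡ true ⇔ T 𝔄 u u (value (proj₁ e (point Fin.zero)))) base≡b
        (relation (proj₂ e) (base k) (base k) (point Fin.zero) ⇔-∘
         mk⇔ traceᵇ (λ { (traceᵇ eq) → eq }))

    -- This is Cantor's diagonal set, with points named by their colours under `q`. Quantifying over
    -- `S` puts it at level `suc ℓ`, where excluded middle is assumed.
    Untraced : ℕ → Set (suc ℓ)
    Untraced k = Σ[ S ∈ Pred (Carrier 𝔄) ℓ ] (S ∈ 𝒥 × Σ[ p ∈ Refinement (Carrier 𝔄) S ]
      (T 𝔄 q (value p) (b k) × ¬ T 𝔄 (b k) (b k) (value p)))

    untraced? : ∀ k → Dec (Untraced k)
    untraced? k = em

    main : ⊥
    main
      with S , S∈𝒥 , e ← realise (does ∘ untraced?)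
      with k , qpk , trace⇔ ← coloured S∈𝒥 e
      -- The point of `e` has colour `k` and traces the diagonal set. If `k` is outside, this point
      -- misses `k` and is itself a witness; if inside, the witness `p′` shares its colour, hence
      -- equals it, yet it traces `k`.
      with untraced? k
    ... | no ¬u = ¬u (S , S∈𝒥 , proj₁ e (point Fin.zero) , qpk , λ kkp →
      contradiction (from trace⇔ kkp) λ ())
    ... | yes (S′ , S′∈𝒥 , p′ , qp′k , ¬kkp′) =
      ¬kkp′ (subst (T 𝔄 (b k) (b k))
               (colour-unique S∈𝒥 S′∈𝒥 (proj₁ e (point Fin.zero)) p′ qpk qp′k)
               (to trace⇔ refl))

theorem2 : (ℓ : Level) → ExcludedMiddle (suc ℓ) →
    Σ[ 𝒜 ∈ Class ℓ ] (IsIdeal 𝒜 × IsBounded ℵ₁ 𝒜 × ¬ Representable 𝒜)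
theorem2 ℓ em = 𝒜 , 𝒜-ideal em , 𝒜-bounded , 𝒜-not-representable em
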